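{- For all $n\ge0$, $$F_{2n}(x,y,q)=\sum_{k=0}^nx^{n-k}y^kq^{\binom{n+k}2-nk}\begin{bmatrix}n\\k\end{bmatrix}_qF_{n-k}(xq^{n+k},yq^{n+k},q).$$
   Context: $\Pi_n(13/2,123)$ is the set of layered matchings of $[n]$: set partitions whose blocks are consecutive intervals $[1,i_1]/\dots/[i_{k-1}+1,n]$, each of size $1$ or $2$. $\Pi_0(13/2,123)$ consists of the empty partition. For $\pi=B_1/\dots/B_k$ with $\min B_1<\dots<\min B_k$, $rb(\pi)$ is the number of pairs $(b,B_j)$ with $b\in B_i$, $j>i$, $\max B_j>b$. Let $s(\pi)$ and $d(\pi)$ be the numbers of blocks of size $1$ and $2$. Define $F_n(x,y,q)=\sum_{\pi\in\Pi_n(13/2,123)}x^{s(\pi)}y^{d(\pi)}q^{rb(\pi)}$. $F_n(xq^a,yq^a,q)$ denotes the substitution $x\mapsto xq^a$, $y\mapsto yq^a$. The $q$-binomial coefficient is $\begin{bmatrix}n\\k\end{bmatrix}_q=\prod_{i=1}^k\frac{q^{n-i+1}-1}{q^i-1}$ for $0\le k\le n$. -}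

module Defs where

open import Algebra.Bundles using (CommutativeRing; Semiring)
open import Data.Fin using (toℕ)
open import Data.List using (List; []; _∷_; _++_; map; foldr; filter; length; concat)
open import Data.List.Membership.Propositional using (_∈_)
open import Data.List.Membership.Propositional.Properties using (∈-map⁺; ∈-map⁻; ∈-++⁺ˡ; ∈-++⁺ʳ; ∈-++⁻)
open import Data.List.Properties using (∷-injective; ∷-injectiveʳ)
open import Data.List.Relation.Unary.All using (All; []; _∷_)
open import Data.List.Relation.Unary.AllPairs using ([]; _∷_)
open import Data.List.Relation.Unary.Any using (here; there)
open import Data.List.Relation.Unary.Unique.Propositional using (Unique)
open import Data.List.Relation.Unary.Unique.Propositional.Properties using (map⁺; ++⁺)
open import Data.Nat using (ℕ; zero; suc; _⊔_; _∸_; _<?_; _≟_; _≤_)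
import Data.Nat as ℕ
open import Data.Nat.Combinatorics using (_C_; nC1≡n; nCk+nC[k+1]≡[n+1]C[k+1])
open import Data.Nat.ListAction using (sum)
open import Data.Nat.Properties using (m≤n+m)
open import Data.Nat.Solver using (module +-*-Solver)
open import Data.Product using (_×_; _,_; ∃-syntax)
open import Data.Sum using (_⊎_; inj₁; inj₂)
open import Relation.Binary.PropositionalEquality using (_≡_; refl; sym; trans; cong; subst)

-- A set partition is the list of its blocks in order of increasing minima,
-- and a block is the increasing list of its elements.

Block : Set
Block = List ℕ

Partition : Set
Partition = List Block

interval : ℕ → ℕ → List ℕ
interval m zero    = []
interval m (suc n) = suc m ∷ interval (suc m) n

-- Blocks are consecutive intervals exactly when, read one after another,
-- they spell out m+1, …, m+n.
IsLayeredMatching : ℕ → ℕ → Partition → Set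
IsLayeredMatching m n π =
  concat π ≡ interval m n × All (λ B → length B ≡ 1 ⊎ length B ≡ 2) π

-- All layered matchings of {m+1, …, m+n}, each listed once (see
-- layered-sound, layered-complete and layered-unique).
layered : ℕ → ℕ → List Partition
layered m zero          = [] ∷ []
layered m (suc zero)    = ((suc m ∷ []) ∷ []) ∷ []
layered m (suc (suc n)) =
  map ((suc m ∷ []) ∷_) (layered (suc m) (suc n))
  ++ map ((suc m ∷ suc (suc m) ∷ []) ∷_) (layered (suc (suc m)) n)

Π : ℕ → List Partition
Π n = layered 0 n

layered-sound : ∀ m n {π} → π ∈ layered m n → IsLayeredMatching m n π
layered-sound m zero       (here refl) = refl , []
layered-sound m (suc zero) (here refl) = refl , inj₁ refl ∷ []
layered-sound m (suc (suc n)) π∈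
  with ∈-++⁻ (map ((suc m ∷ []) ∷_) (layered (suc m) (suc n))) π∈
... | inj₁ p with ∈-map⁻ _ p
...   | _ , q , refl with layered-sound (suc m) (suc n) q
...     | e , a = cong (suc m ∷_) e , inj₁ refl ∷ a
layered-sound m (suc (suc n)) π∈ | inj₂ p with ∈-map⁻ _ p
...   | _ , q , refl with layered-sound (suc (suc m)) n q
...     | e , a = cong (λ l → suc m ∷ suc (suc m) ∷ l) e , inj₂ refl ∷ a

layered-complete : ∀ m n {π} → IsLayeredMatching m n π → π ∈ layered m n
layered-complete m zero {[]} _ = here refl
layered-complete m zero {[] ∷ π} (_ , inj₁ () ∷ _)
layered-complete m zero {[] ∷ π} (_ , inj₂ () ∷ _)
layered-complete m zero {(_ ∷ _) ∷ π} (() , _)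
layered-complete m (suc n) {[]} (() , _)
layered-complete m (suc n) {[] ∷ π} (_ , inj₁ () ∷ _)
layered-complete m (suc n) {[] ∷ π} (_ , inj₂ () ∷ _)
layered-complete m (suc n) {(b ∷ _ ∷ _ ∷ _) ∷ π} (_ , inj₁ () ∷ _)
layered-complete m (suc n) {(b ∷ _ ∷ _ ∷ _) ∷ π} (_ , inj₂ () ∷ _)
layered-complete m (suc zero) {(b ∷ []) ∷ π} (e , _ ∷ a)
  with ∷-injective e
... | refl , e′ with layered-complete (suc m) zero {π} (e′ , a)
...   | here refl = here refl
layered-complete m (suc zero) {(b ∷ c ∷ []) ∷ π} (() , _)
layered-complete m (suc (suc n)) {(b ∷ []) ∷ π} (e , _ ∷ a)
  with ∷-injective e
... | refl , e′ = ∈-++⁺ˡ (∈-map⁺ _ (layered-complete (suc m) (suc n) (e′ , a)))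
layered-complete m (suc (suc n)) {(b ∷ c ∷ []) ∷ π} (e , _ ∷ a)
  with ∷-injective e
... | refl , e′ with ∷-injective e′
...   | refl , e″ = ∈-++⁺ʳ (map ((suc m ∷ []) ∷_) (layered (suc m) (suc n)))
                      (∈-map⁺ _ (layered-complete (suc (suc m)) n (e″ , a)))

layered-unique : ∀ m n → Unique (layered m n)
layered-unique m zero       = [] ∷ []
layered-unique m (suc zero) = [] ∷ []
layered-unique m (suc (suc n)) =
  ++⁺ (map⁺ ∷-injectiveʳ (layered-unique (suc m) (suc n)))
      (map⁺ ∷-injectiveʳ (layered-unique (suc (suc m)) n))
      λ (p , q) → disjoint (∈-map⁻ _ p) (∈-map⁻ _ q)
  where
  disjoint : ∀ {π ρs σs} →
             ∃[ ρ ] (ρ ∈ ρs × π ≡ (suc m ∷ []) ∷ ρ) →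
             ∃[ σ ] (σ ∈ σs × π ≡ (suc m ∷ suc (suc m) ∷ []) ∷ σ) → _
  disjoint (_ , _ , refl) (_ , _ , ())

maxBlock : Block → ℕ
maxBlock = foldr _⊔_ 0

-- The sum over b ∈ B counts the blocks B′ to the right of B with max B′ > b.
rb : Partition → ℕ
rb []      = 0
rb (B ∷ π) = sum (map (λ b → length (filter (λ B′ → b <? maxBlock B′) π)) B) ℕ.+ rb π

singletons : Partition → ℕ
singletons π = length (filter (λ B → length B ≟ 1) π)

doubletons : Partition → ℕ
doubletons π = length (filter (λ B → length B ≟ 2) π)

-- The truncated subtraction C(n+k,2) ∸ nk in the statement never truncates.
nk≤[n+k]C2 : ∀ n k → n ℕ.* k ≤ (n ℕ.+ k) C 2
nk≤[n+k]C2 n k = subst (n ℕ.* k ≤_) (sym (split n)) (m≤n+m _ (n C 2 ℕ.+ k C 2))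
  where
  open +-*-Solver
  step : ∀ j → suc j C 2 ≡ j ℕ.+ j C 2
  step j = trans (sym (nCk+nC[k+1]≡[n+1]C[k+1] j 1)) (cong (ℕ._+ j C 2) (nC1≡n j))
  split : ∀ j → (j ℕ.+ k) C 2 ≡ (j C 2 ℕ.+ k C 2) ℕ.+ j ℕ.* k
  split zero    = solve 1 (λ c → c := (con 0 :+ c) :+ con 0) refl (k C 2)
  split (suc j) =
    trans (step (j ℕ.+ k))
    (trans (cong ((j ℕ.+ k) ℕ.+_) (split j))
    (trans (solve 5 (λ j k a b p → (j :+ k) :+ ((a :+ b) :+ p)
                                   := ((j :+ a) :+ b) :+ (k :+ p))
                  refl j k (j C 2) (k C 2) (j ℕ.* k))
           (cong (λ t → (t ℕ.+ k C 2) ℕ.+ (k ℕ.+ j ℕ.* k)) (sym (step j)))))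

-- The weights x, y, q are arbitrary elements of a commutative ring R in which
-- the denominators qⁱ - 1 are invertible.  With R = ℚ(x,y,q) or
-- R = ℤ[x,y][[q]] they are the indeterminates themselves.
module Weighted {c ℓ} (R : CommutativeRing c ℓ) where
  open CommutativeRing R
  open import Algebra.Properties.Semiring.Exp semiring public using (_^_)
  open import Algebra.Definitions.RawSemiring (Semiring.rawSemiring semiring) public
    using (product)
  open import Algebra.Properties.Semiring.Sum semiring public using (sum-syntax)

  F : ℕ → Carrier → Carrier → Carrier → Carrier
  F n x y q =
    foldr _+_ 0# (map (λ π → x ^ singletons π * y ^ doubletons π * q ^ rb π) (Π n))

  -- recip i stands for 1 / (qⁱ - 1); only 1 ≤ i ≤ n matters.
  Reciprocals : ℕ → Carrier → (ℕ → Carrier) → Set ℓ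
  Reciprocals n q recip = ∀ i → 1 ≤ i → i ≤ n → (q ^ i - 1#) * recip i ≈ 1#

  -- The factor with Fin index j is the one for i = j + 1.
  qBinomial : Carrier → (ℕ → Carrier) → ℕ → ℕ → Carrier
  qBinomial q recip n k = product {k} λ j →
    let i = suc (toℕ j) in (q ^ (n ∸ i ℕ.+ 1) - 1#) * recip i

-- Cut a layered matching of [2n] after its first n blocks, k of them doubletons: these
-- cover [n+k], and what is left is a layered matching of a set of size n - k. Since rb
-- counts, for each block B, the elements preceding B, every later block gains a factor
-- q^(n+k). The first n blocks are counted by induction on their number, where the last
-- one contributes the q-Pascal recurrence.
module Submission where

open import Defs
open import Algebra.Bundles using (CommutativeRing)
open import Data.Fin using (toℕ)
open import Data.Nat using (ℕ; suc; _∸_)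
open import Data.Nat.Combinatorics using (_C_)
import Data.Nat as ℕ
open import Data.Nat using (zero; _≤_; _<_; z≤n; s≤s; _<?_)
open import Data.Nat.Combinatorics using (nC1≡n; nCk+nC[k+1]≡[n+1]C[k+1])
import Data.Nat.ListAction as ListAction
import Data.Nat.Properties as ℕₚ
import Data.Nat.Solver
import Algebra.Properties.CommutativeMonoid.Sum as CommutativeMonoidSum
import Algebra.Properties.CommutativeSemiring.Exp as CommutativeSemiringExp
import Algebra.Properties.Semiring.Exp as SemiringExp
import Algebra.Properties.Semiring.Sum as SemiringSum
import Algebra.Solver.Ring.NaturalCoefficients.Default as SemiringSolver
import Data.Fin.Properties as Finₚ
open import Data.List using (List; []; _∷_; _++_; map; foldr; filter; length)
open import Data.List.Properties using (filter-all)
open import Data.List.Relation.Unary.All as All using (All; []; _∷_)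
open import Data.List.Relation.Unary.All.Properties using (map⁺; ++⁺)
open import Data.Product using (_,_; proj₂)
open import Data.Sum using (_⊎_; inj₁; inj₂)
open import Function using (_∘_)
open import Relation.Binary.PropositionalEquality as ≡ using (_≡_)
import Relation.Binary.Reasoning.Setoid as SetoidReasoning

-- Maxima of blocks, numbers of blocks and `rb` for layered matchings.

-- With `m` the last element already placed, every later block passes the filter in `rb`.
layered-max : ∀ m n → All (All (λ B → m < maxBlock B)) (layered m n)
layered-max m zero          = [] ∷ []
layered-max m (suc zero)    = (ℕₚ.m≤m⊔n (suc m) 0 ∷ []) ∷ []
layered-max m (suc (suc n)) = ++⁺
  (map⁺ (All.map (λ a → ℕₚ.m≤m⊔n (suc m) 0 ∷ All.map ℕₚ.<⇒≤ a)
                 (layered-max (suc m) (suc n))))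
  (map⁺ (All.map (λ a → ℕₚ.m≤m⊔n (suc m) (suc (suc m) ℕ.⊔ 0) ∷ All.map (ℕₚ.<⇒≤ ∘ ℕₚ.<⇒≤) a)
                 (layered-max (suc (suc m)) n)))

-- Each block carries exactly one factor x or y, so a factor per block can be absorbed by rescaling
-- both variables.
length≡singletons+doubletons : ∀ {π} → All (λ B → length B ≡ 1 ⊎ length B ≡ 2) π →
                               length π ≡ singletons π ℕ.+ doubletons π
length≡singletons+doubletons [] = ≡.refl
length≡singletons+doubletons {(_ ∷ []) ∷ π} (_ ∷ a) =
  ≡.cong suc (length≡singletons+doubletons a)
length≡singletons+doubletons {(_ ∷ _ ∷ []) ∷ π} (_ ∷ a) =
  ≡.trans (≡.cong suc (length≡singletons+doubletons a))
          (≡.sym (ℕₚ.+-suc (singletons π) (doubletons π)))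
length≡singletons+doubletons {[] ∷ π} (inj₁ () ∷ _)
length≡singletons+doubletons {[] ∷ π} (inj₂ () ∷ _)
length≡singletons+doubletons {(_ ∷ _ ∷ _ ∷ _) ∷ π} (inj₁ () ∷ _)
length≡singletons+doubletons {(_ ∷ _ ∷ _ ∷ _) ∷ π} (inj₂ () ∷ _)

layered-length : ∀ m n → All (λ π → length π ≡ singletons π ℕ.+ doubletons π) (layered m n)
layered-length m n =
  All.tabulate (λ π∈ → length≡singletons+doubletons (proj₂ (layered-sound m n π∈)))

-- Under the hypothesis no later block is filtered out, so each element of `B` contributes
-- `length π`.
rb-∷ : ∀ B π → All (λ b → All (λ B′ → b < maxBlock B′) π) B →
       rb (B ∷ π) ≡ length B ℕ.* length π ℕ.+ rb π
rb-∷ B π a = ≡.cong (ℕ._+ rb π) (go a)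
  where
  go : ∀ {B} → All (λ b → All (λ B′ → b < maxBlock B′) π) B →
       ListAction.sum (map (λ b → length (filter (λ B′ → b <? maxBlock B′) π)) B)
       ≡ length B ℕ.* length π
  go []      = ≡.refl
  go (p ∷ a) = ≡.cong₂ ℕ._+_ (≡.cong length (filter-all (λ B′ → _ <? maxBlock B′) p)) (go a)

-- Binomial identities for the exponents of q.

suc-C2 : ∀ n → suc n C 2 ≡ n ℕ.+ n C 2
suc-C2 n = ≡.trans (≡.sym (nCk+nC[k+1]≡[n+1]C[k+1] n 1)) (≡.cong (ℕ._+ n C 2) (nC1≡n n))

-- A pair from a disjoint union of sets of sizes n and k lies in the first, lies in the second, or
-- takes one element from each.
[n+k]C2 : ∀ n k → (n ℕ.+ k) C 2 ≡ (n C 2 ℕ.+ k C 2) ℕ.+ n ℕ.* k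
[n+k]C2 zero    k = ≡.sym (ℕₚ.+-identityʳ (k C 2))
[n+k]C2 (suc n) k = begin
  suc (n ℕ.+ k) C 2                                     ≡⟨ suc-C2 (n ℕ.+ k) ⟩
  (n ℕ.+ k) ℕ.+ (n ℕ.+ k) C 2                           ≡⟨ ≡.cong ((n ℕ.+ k) ℕ.+_) ([n+k]C2 n k) ⟩
  (n ℕ.+ k) ℕ.+ ((n C 2 ℕ.+ k C 2) ℕ.+ n ℕ.* k)         ≡⟨ rearrange n k (n C 2) (k C 2) (n ℕ.* k) ⟩
  ((n ℕ.+ n C 2) ℕ.+ k C 2) ℕ.+ (k ℕ.+ n ℕ.* k)         ≡⟨ ≡.cong (λ t → (t ℕ.+ k C 2) ℕ.+ (k ℕ.+ n ℕ.* k)) (≡.sym (suc-C2 n)) ⟩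
  (suc n C 2 ℕ.+ k C 2) ℕ.+ (k ℕ.+ n ℕ.* k)             ∎
  where
  open ≡.≡-Reasoning
  open Data.Nat.Solver.+-*-Solver
  rearrange : ∀ n k a b p → (n ℕ.+ k) ℕ.+ ((a ℕ.+ b) ℕ.+ p) ≡ ((n ℕ.+ a) ℕ.+ b) ℕ.+ (k ℕ.+ p)
  rearrange = solve 5 (λ n k a b p → (n :+ k) :+ ((a :+ b) :+ p)
                                     := ((n :+ a) :+ b) :+ (k :+ p)) ≡.refl

[n+k]C2∸nk : ∀ n k → (n ℕ.+ k) C 2 ∸ n ℕ.* k ≡ n C 2 ℕ.+ k C 2
[n+k]C2∸nk n k = ≡.trans (≡.cong (_∸ n ℕ.* k) ([n+k]C2 n k)) (ℕₚ.m+n∸n≡m _ (n ℕ.* k))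

module _ where
  open Data.Nat.Solver.+-*-Solver

  -- This and the next two identities balance the powers of q when a block is appended to `a`
  -- blocks. The summands `a + 0`, `a + s` (with `s` later `suc k`) and `a + k` count the elements
  -- preceding the new block.
  zero-exponent : ∀ a → suc a C 2 ℕ.+ 0 ≡ (a ℕ.+ 0) ℕ.+ (a C 2 ℕ.+ 0)
  zero-exponent a = ≡.trans (≡.cong (ℕ._+ 0) (suc-C2 a))
    (solve 2 (λ a c → a :+ c :+ con 0 := (a :+ con 0) :+ (c :+ con 0)) ≡.refl a (a C 2))

  suc-C2-exponent : ∀ a d s → suc a C 2 ℕ.+ d ℕ.+ s ≡ a C 2 ℕ.+ d ℕ.+ (a ℕ.+ s)
  suc-C2-exponent a d s = ≡.trans (≡.cong (λ c → c ℕ.+ d ℕ.+ s) (suc-C2 a))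
    (solve 4 (λ a c d s → a :+ c :+ d :+ s := c :+ d :+ (a :+ s)) ≡.refl a (a C 2) d s)

  pascal-exponent : ∀ a k → suc a C 2 ℕ.+ suc k C 2 ≡ a C 2 ℕ.+ k C 2 ℕ.+ (a ℕ.+ k)
  pascal-exponent a k = ≡.trans (≡.cong₂ ℕ._+_ (suc-C2 a) (suc-C2 k))
    (solve 4 (λ a c k d → a :+ c :+ (k :+ d) := c :+ d :+ (a :+ k)) ≡.refl a (a C 2) k (k C 2))

module _ {c ℓ} (R : CommutativeRing c ℓ) where
  open CommutativeRing R
  open Weighted R
  open SemiringExp semiring using (^-homo-*; ^-assocʳ; ^-congˡ; ^-congʳ)
  open CommutativeSemiringExp commutativeSemiring using (^-distrib-*)
  open SemiringSum semiring
    using (sum; sum-cong-≋; sum-init-last; ∑-distrib-+)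
  private
    module Π = CommutativeMonoidSum *-commutativeMonoid
  open SemiringSolver commutativeSemiring using (solve; _:+_; _:*_; _:=_)
  open SetoidReasoning setoid

  -- Weights of matchings and the recurrence for `F`.

  total : (Partition → Carrier) → List Partition → Carrier
  total f = foldr _+_ 0# ∘ map f

  total-++ : ∀ f πs ρs → total f (πs ++ ρs) ≈ total f πs + total f ρs
  total-++ f []       ρs = sym (+-identityˡ _)
  total-++ f (π ∷ πs) ρs = trans (+-congˡ (total-++ f πs ρs)) (sym (+-assoc _ _ _))

  total-scale : ∀ {f g h a πs} → All (λ π → f (g π) ≈ a * h π) πs →
                total f (map g πs) ≈ a * total h πs
  total-scale []      = sym (zeroʳ _)
  total-scale (e ∷ a) = trans (+-cong e (total-scale a)) (sym (distribˡ _ _ _))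

  total-cong : ∀ {f g} → (∀ π → f π ≈ g π) → ∀ πs → total f πs ≈ total g πs
  total-cong e []       = refl
  total-cong e (π ∷ πs) = +-cong (e π) (total-cong e πs)

  weight : Carrier → Carrier → Carrier → Partition → Carrier
  weight x y q π = x ^ singletons π * y ^ doubletons π * q ^ rb π

  -- The substitution gives one factor `q ^ a` for every singleton and every doubleton, hence one
  -- per block.
  weight-shift : ∀ x y q a π → length π ≡ singletons π ℕ.+ doubletons π →
                 weight (x * q ^ a) (y * q ^ a) q π ≈ weight x y q π * q ^ (a ℕ.* length π)
  weight-shift x y q a π e = begin
    (x * u) ^ s * (y * u) ^ d * r
      ≈⟨ *-congʳ (*-cong (^-distrib-* x u s) (^-distrib-* y u d)) ⟩
    x ^ s * u ^ s * (y ^ d * u ^ d) * r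
      ≈⟨ solve 5 (λ a b c d e → a :* b :* (c :* d) :* e := a :* c :* e :* (b :* d)) refl
           (x ^ s) (u ^ s) (y ^ d) (u ^ d) r ⟩
    x ^ s * y ^ d * r * (u ^ s * u ^ d)
      ≈⟨ *-congˡ (^-homo-* u s d) ⟨
    x ^ s * y ^ d * r * u ^ (s ℕ.+ d)
      ≈⟨ *-congˡ (^-congʳ u e) ⟨
    x ^ s * y ^ d * r * u ^ length π
      ≈⟨ *-congˡ (^-assocʳ q a (length π)) ⟩
    x ^ s * y ^ d * r * q ^ (a ℕ.* length π) ∎
    where
    s = singletons π
    d = doubletons π
    r = q ^ rb π
    u = q ^ a

  -- The element `b` is counted once for each later block; this factor q per block is the
  -- substitution with a = 1.
  weight-singleton : ∀ x y q b π → All (λ B → b < maxBlock B) π →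
                     length π ≡ singletons π ℕ.+ doubletons π →
                     weight x y q ((b ∷ []) ∷ π) ≈ x * weight (x * q ^ 1) (y * q ^ 1) q π
  weight-singleton x y q b π a e = begin
    x * X * Y * q ^ rb ((b ∷ []) ∷ π)
      ≈⟨ *-congˡ (trans (^-congʳ q (rb-∷ (b ∷ []) π (a ∷ []))) (^-homo-* q (1 ℕ.* length π) (rb π))) ⟩
    x * X * Y * (u * r)
      ≈⟨ solve 5 (λ x a b u r → x :* a :* b :* (u :* r) := x :* (a :* b :* r :* u)) refl x X Y u r ⟩
    x * (X * Y * r * u)
      ≈⟨ *-congˡ (weight-shift x y q 1 π e) ⟨
    x * weight (x * q ^ 1) (y * q ^ 1) q π ∎
    where
    X = x ^ singletons π
    Y = y ^ doubletons π
    r = q ^ rb π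
    u = q ^ (1 ℕ.* length π)

  -- Now two elements are counted for each later block, so the substitution has a = 2.
  weight-doubleton : ∀ x y q b b′ π → All (λ B → b < maxBlock B) π → All (λ B → b′ < maxBlock B) π →
                     length π ≡ singletons π ℕ.+ doubletons π →
                     weight x y q ((b ∷ b′ ∷ []) ∷ π) ≈ y * weight (x * q ^ 2) (y * q ^ 2) q π
  weight-doubleton x y q b b′ π a a′ e = begin
    X * (y * Y) * q ^ rb ((b ∷ b′ ∷ []) ∷ π)
      ≈⟨ *-congˡ (trans (^-congʳ q (rb-∷ (b ∷ b′ ∷ []) π (a ∷ a′ ∷ []))) (^-homo-* q (2 ℕ.* length π) (rb π))) ⟩
    X * (y * Y) * (u * r)
      ≈⟨ solve 5 (λ y a b u r → a :* (y :* b) :* (u :* r) := y :* (a :* b :* r :* u)) refl y X Y u r ⟩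
    y * (X * Y * r * u)
      ≈⟨ *-congˡ (weight-shift x y q 2 π e) ⟨
    y * weight (x * q ^ 2) (y * q ^ 2) q π ∎
    where
    X = x ^ singletons π
    Y = y ^ doubletons π
    r = q ^ rb π
    u = q ^ (2 ℕ.* length π)

  total-layered : ∀ m n x y q →
    total (weight x y q) (layered m (suc (suc n)))
    ≈ x * total (weight (x * q ^ 1) (y * q ^ 1) q) (layered (suc m) (suc n))
      + y * total (weight (x * q ^ 2) (y * q ^ 2) q) (layered (suc (suc m)) n)
  total-layered m n x y q =
    trans (total-++ _ (map ((suc m ∷ []) ∷_) (layered (suc m) (suc n))) _)
      (+-cong
        (total-scale (All.zipWith (λ (a , e) → weight-singleton x y q _ _ a e)
          (layered-max (suc m) (suc n) , layered-length (suc m) (suc n))))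
        (total-scale (All.zipWith (λ (a , e) → weight-doubleton x y q _ _ _ (All.map ℕₚ.<⇒≤ a) a e)
          (layered-max (suc (suc m)) n , layered-length (suc (suc m)) n))))

  -- The recurrence by the first block has coefficients independent of `m`, and so do the initial
  -- values.
  total-layered-translate : ∀ m n x y q →
    total (weight x y q) (layered m n) ≈ F n x y q
  total-layered-translate m zero          x y q = refl
  total-layered-translate m (suc zero)    x y q = refl
  total-layered-translate m (suc (suc n)) x y q = begin
    total (weight x y q) (layered m (suc (suc n)))
      ≈⟨ total-layered m n x y q ⟩
    -- By induction the totals starting from `suc m` and from 1 equal the same `F`, as do those from
    -- `suc (suc m)` and from 2. The right-hand side is thus the recurrence for m = 0.
    _ ≈⟨ +-cong (*-congˡ (trans (total-layered-translate (suc m) (suc n) _ _ q)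
                                (sym (total-layered-translate 1 (suc n) _ _ q))))
                (*-congˡ (trans (total-layered-translate (suc (suc m)) n _ _ q)
                                (sym (total-layered-translate 2 n _ _ q)))) ⟩
    _ ≈⟨ total-layered 0 n x y q ⟨
    F (suc (suc n)) x y q ∎

  F-suc-suc : ∀ n x y q →
    F (suc (suc n)) x y q ≈ x * F (suc n) (x * q ^ 1) (y * q ^ 1) q
                            + y * F n (x * q ^ 2) (y * q ^ 2) q
  F-suc-suc n x y q = trans (total-layered 0 n x y q)
    (+-cong (*-congˡ (total-layered-translate 1 (suc n) _ _ q))
            (*-congˡ (total-layered-translate 2 n _ _ q)))

  F-cong : ∀ {m n x x′ y y′} q → m ≡ n → x ≈ x′ → y ≈ y′ → F m x y q ≈ F n x′ y′ q
  F-cong {m} q ≡.refl ex ey = total-cong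
    (λ π → *-congʳ (*-cong (^-congˡ (singletons π) ex) (^-congˡ (doubletons π) ey))) (Π m)

  -- Here `j` is the number of elements in front of the matching; splitting off the first block
  -- raises it by 1 or 2.
  F-shift-recurrence : ∀ {N} j x y q → 2 ≤ N →
    F N (x * q ^ j) (y * q ^ j) q
    ≈ x * q ^ j * F (N ∸ 1) (x * q ^ (1 ℕ.+ j)) (y * q ^ (1 ℕ.+ j)) q
      + y * q ^ j * F (N ∸ 2) (x * q ^ (2 ℕ.+ j)) (y * q ^ (2 ℕ.+ j)) q
  F-shift-recurrence {suc (suc N)} j x y q (s≤s (s≤s _)) = trans (F-suc-suc N _ _ q)
    (+-cong (*-congˡ (F-cong {suc N} q ≡.refl (merge x 1) (merge y 1)))
            (*-congˡ (F-cong {N} q ≡.refl (merge x 2) (merge y 2))))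
    where
    merge : ∀ z i → z * q ^ j * q ^ i ≈ z * q ^ (i ℕ.+ j)
    merge z i = begin
      z * q ^ j * q ^ i   ≈⟨ *-assoc _ _ _ ⟩
      z * (q ^ j * q ^ i) ≈⟨ *-congˡ (*-comm _ _) ⟩
      z * (q ^ i * q ^ j) ≈⟨ *-congˡ (^-homo-* q i j) ⟨
      z * q ^ (i ℕ.+ j)   ∎

  -- Gaussian coefficients from the q-Pascal recurrence.

  -- Unlike qBinomial this needs no reciprocals and vanishes for k > n.
  gauss : Carrier → ℕ → ℕ → Carrier
  gauss q n       zero    = 1#
  gauss q zero    (suc k) = 0#
  gauss q (suc n) (suc k) = q ^ suc k * gauss q n (suc k) + gauss q n k

  gauss-vanishes : ∀ q {n k} → n < k → gauss q n k ≈ 0#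
  gauss-vanishes q {zero}  (s≤s _)         = refl
  gauss-vanishes q {suc n} {suc k} (s≤s p) = begin
    q ^ suc k * gauss q n (suc k) + gauss q n k
      ≈⟨ +-cong (*-congˡ (gauss-vanishes q (ℕₚ.m<n⇒m<1+n p))) (gauss-vanishes q p) ⟩
    q ^ suc k * 0# + 0# ≈⟨ +-identityʳ _ ⟩
    q ^ suc k * 0#      ≈⟨ zeroʳ _ ⟩
    0#                  ∎

  -- Finite sums and products indexed through `toℕ`.

  sum-toℕ-cong : ∀ n (f g : ℕ → Carrier) → (∀ k → k < n → f k ≈ g k) →
                 sum {n} (f ∘ toℕ) ≈ sum {n} (g ∘ toℕ)
  sum-toℕ-cong n f g e = sum-cong-≋ {n} (λ i → e (toℕ i) (Finₚ.toℕ<n i))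

  sum-toℕ-last : ∀ n (f : ℕ → Carrier) →
                 sum {suc n} (f ∘ toℕ) ≈ sum {n} (f ∘ toℕ) + f n
  sum-toℕ-last n f = trans (sum-init-last {n} (f ∘ toℕ))
    (+-cong (sum-cong-≋ {n} (λ i → reflexive (≡.cong f (Finₚ.toℕ-inject₁ i))))
            (reflexive (≡.cong f (Finₚ.toℕ-fromℕ n))))

  product-toℕ-last : ∀ n (f : ℕ → Carrier) →
                     product {suc n} (f ∘ toℕ) ≈ product {n} (f ∘ toℕ) * f n
  product-toℕ-last n f = trans (Π.sum-init-last {n} (f ∘ toℕ))
    (*-cong (Π.sum-cong-≋ {n} (λ i → reflexive (≡.cong f (Finₚ.toℕ-inject₁ i))))
            (reflexive (≡.cong f (Finₚ.toℕ-fromℕ n))))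

  -- The product formula for Gaussian coefficients.

  x-1+1 : ∀ x → x - 1# + 1# ≈ x
  x-1+1 x = trans (+-assoc x (- 1#) 1#) (trans (+-congˡ (-‿inverseˡ 1#)) (+-identityʳ x))

  x+1-1 : ∀ x → x + 1# - 1# ≈ x
  x+1-1 x = trans (+-assoc x 1# (- 1#)) (trans (+-congˡ (-‿inverseʳ 1#)) (+-identityʳ x))

  -- For u = q^(k+1) and v = q^(n-k) the right-hand side is q^(n+1) - 1; this is why the product
  -- formula satisfies the q-Pascal recurrence.
  u[v-1]+[u-1] : ∀ u v → u * (v - 1#) + (u - 1#) ≈ u * v - 1#
  u[v-1]+[u-1] u v = begin
    u * w + p                   ≈⟨ x+1-1 _ ⟨
    u * w + p + 1# - 1#         ≈⟨ +-congʳ (trans (+-assoc _ _ _) (+-congˡ (x-1+1 u))) ⟩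
    u * w + u - 1#              ≈⟨ +-congʳ (+-congˡ (*-identityʳ u)) ⟨
    u * w + u * 1# - 1#         ≈⟨ +-congʳ (distribˡ u w 1#) ⟨
    u * (w + 1#) - 1#           ≈⟨ +-congʳ (*-congˡ (x-1+1 v)) ⟩
    u * v - 1#                  ∎
    where
    p = u - 1#
    w = v - 1#

  -- The exponent keeps the form it has in `qBinomial`, so that `qBinomial` splits factor by factor
  -- into this product and the reciprocals.
  numerator : Carrier → ℕ → ℕ → Carrier
  numerator q n k = product {k} λ j → q ^ (n ∸ suc (toℕ j) ℕ.+ 1) - 1#

  denominator : Carrier → ℕ → Carrier
  denominator q k = product {k} λ j → q ^ suc (toℕ j) - 1#

  numerator-head : ∀ q n k → numerator q (suc n) (suc k) ≈ (q ^ suc n - 1#) * numerator q n k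
  numerator-head q n k = *-congʳ (+-congʳ (^-congʳ q (ℕₚ.+-comm n 1)))

  numerator-last : ∀ q {n k} → k < n →
                   numerator q n (suc k) ≈ numerator q n k * (q ^ (n ∸ k) - 1#)
  numerator-last q {n} {k} k<n = trans
    (product-toℕ-last k (λ j → q ^ (n ∸ suc j ℕ.+ 1) - 1#))
    (*-congˡ (+-congʳ (^-congʳ q
      (≡.trans (ℕₚ.+-comm (n ∸ suc k) 1) (≡.sym (ℕₚ.+-∸-assoc 1 k<n))))))

  -- The product formula with denominators cleared, so that the induction along q-Pascal involves no
  -- division.
  gauss-denominator : ∀ q n k → k ≤ n → gauss q n k * denominator q k ≈ numerator q n k
  -- The same formula one column further, in a form that also covers k = n, where both sides are
  -- zero.
  gauss-denominator-suc : ∀ q n k → k ≤ n →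
    gauss q n (suc k) * denominator q (suc k) ≈ numerator q n k * (q ^ (n ∸ k) - 1#)

  gauss-denominator q n       zero    _       = *-identityˡ 1#
  gauss-denominator q (suc n) (suc k) (s≤s p) = begin
    (u * g′ + g) * D′
      ≈⟨ solve 4 (λ u h g d → (u :* h :+ g) :* d := u :* (h :* d) :+ g :* d) refl u g′ g D′ ⟩
    u * (g′ * D′) + g * D′
      ≈⟨ +-cong (*-congˡ (gauss-denominator-suc q n k p))
                (trans (*-congˡ (product-toℕ-last k (λ j → q ^ suc j - 1#)))
                  (trans (sym (*-assoc _ _ _)) (*-congʳ (gauss-denominator q n k p)))) ⟩
    u * (N * (v - 1#)) + N * (u - 1#)
      ≈⟨ solve 4 (λ u N w p → u :* (N :* w) :+ N :* p := (u :* w :+ p) :* N) refl u N (v - 1#) (u - 1#) ⟩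
    (u * (v - 1#) + (u - 1#)) * N
      ≈⟨ *-congʳ (u[v-1]+[u-1] u v) ⟩
    (u * v - 1#) * N
      ≈⟨ *-congʳ (+-congʳ (trans (sym (^-homo-* q (suc k) (n ∸ k)))
                                 (^-congʳ q (≡.cong suc (ℕₚ.m+[n∸m]≡n p))))) ⟩
    (q ^ suc n - 1#) * N
      ≈⟨ numerator-head q n k ⟨
    numerator q (suc n) (suc k) ∎
    where
    u  = q ^ suc k
    v  = q ^ (n ∸ k)
    g  = gauss q n k
    g′ = gauss q n (suc k)
    D′ = denominator q (suc k)
    N  = numerator q n k

  gauss-denominator-suc q n k k≤n with ℕₚ.m≤n⇒m<n∨m≡n k≤n
  ... | inj₁ k<n    = trans (gauss-denominator q n (suc k) k<n) (numerator-last q k<n)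
  -- For k = n the truncated exponent `n ∸ suc n + 1` would be 1 instead of 0, so
  -- `numerator q n (suc n)` cannot be used. The factor `q ^ (n ∸ n) - 1#` gives the required zero.
  ... | inj₂ ≡.refl = begin
    gauss q n (suc n) * denominator q (suc n) ≈⟨ *-congʳ (gauss-vanishes q (ℕₚ.n<1+n n)) ⟩
    0# * denominator q (suc n)                ≈⟨ zeroˡ _ ⟩
    0#                                        ≈⟨ zeroʳ _ ⟨
    numerator q n n * 0#                      ≈⟨ *-congˡ (-‿inverseʳ 1#) ⟨
    numerator q n n * (q ^ 0 - 1#)            ≈⟨ *-congˡ (+-congʳ (^-congʳ q (ℕₚ.n∸n≡0 n))) ⟨
    numerator q n n * (q ^ (n ∸ n) - 1#)      ∎

  denominator-recip : ∀ {q recip n} → Reciprocals n q recip → ∀ k → k ≤ n →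
                      denominator q k * product {k} (λ j → recip (suc (toℕ j))) ≈ 1#
  denominator-recip {q} {recip} inv k k≤n = begin
    denominator q k * product {k} (λ j → recip (suc (toℕ j)))
      ≈⟨ Π.∑-distrib-+ {k} (λ j → q ^ suc (toℕ j) - 1#) (λ j → recip (suc (toℕ j))) ⟨
    product {k} (λ j → (q ^ suc (toℕ j) - 1#) * recip (suc (toℕ j)))
      ≈⟨ Π.sum-cong-≋ {k} (λ j → inv _ (s≤s z≤n) (ℕₚ.≤-trans (Finₚ.toℕ<n j) k≤n)) ⟩
    product {k} (λ _ → 1#)
      ≈⟨ Π.sum-replicate-zero k ⟩
    1# ∎

  qBinomial≈gauss : ∀ {q recip n} → Reciprocals n q recip → ∀ k → k ≤ n →
                    qBinomial q recip n k ≈ gauss q n k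
  qBinomial≈gauss {q} {recip} {n} inv k k≤n = begin
    qBinomial q recip n k                 ≈⟨ Π.∑-distrib-+ {k} _ (λ j → recip (suc (toℕ j))) ⟩
    numerator q n k * r                   ≈⟨ *-congʳ (gauss-denominator q n k k≤n) ⟨
    gauss q n k * denominator q k * r     ≈⟨ *-assoc _ _ _ ⟩
    gauss q n k * (denominator q k * r)   ≈⟨ *-congˡ (denominator-recip inv k k≤n) ⟩
    gauss q n k * 1#                      ≈⟨ *-identityʳ _ ⟩
    gauss q n k                           ∎
    where r = product {k} (λ j → recip (suc (toℕ j)))

  -- Cutting a layered matching after its first `a` blocks.

  -- Transposition of a Pascal-type rule: instead of building the row `t′` from `t`, the rule is
  -- applied to `h`. The proof splits the sum in two and shifts the index in the `β` part.
  sum-pascal : ∀ a (t t′ α β h : ℕ → Carrier) →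
    t′ 0 ≈ t 0 * α 0 → (∀ k → t′ (suc k) ≈ t (suc k) * α (suc k) + t k * β k) →
    t (suc a) ≈ 0# →
    ∑[ i < suc (suc a) ] (t′ (toℕ i) * h (toℕ i))
    ≈ ∑[ i < suc a ] (t (toℕ i) * (α (toℕ i) * h (toℕ i) + β (toℕ i) * h (suc (toℕ i))))
  sum-pascal a t t′ α β h e₀ e₊ tₐ≈0 = begin
    t′ 0 * h 0 + ∑[ i < suc a ] (t′ (suc (toℕ i)) * h (suc (toℕ i)))
      ≈⟨ +-cong (*-congʳ e₀) (sum-toℕ-cong (suc a) (λ k → t′ (suc k) * h (suc k)) (λ k → f (suc k) + g k)
             (λ k _ → trans (*-congʳ (e₊ k)) (distribʳ _ _ _))) ⟩
    f 0 + ∑[ i < suc a ] (f (suc (toℕ i)) + g (toℕ i))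
      ≈⟨ +-congˡ (∑-distrib-+ {suc a} (f ∘ suc ∘ toℕ) (g ∘ toℕ)) ⟩
    f 0 + (∑[ i < suc a ] f (suc (toℕ i)) + ∑[ i < suc a ] g (toℕ i))
      ≈⟨ +-assoc _ _ _ ⟨
    ∑[ i < suc (suc a) ] f (toℕ i) + ∑[ i < suc a ] g (toℕ i)
      -- The `α` part has one term too many, at index `suc a`, where `t` vanishes.
      ≈⟨ +-congʳ (trans (sum-toℕ-last (suc a) f) (trans (+-congˡ fₐ≈0) (+-identityʳ _))) ⟩
    ∑[ i < suc a ] f (toℕ i) + ∑[ i < suc a ] g (toℕ i)
      ≈⟨ ∑-distrib-+ {suc a} (f ∘ toℕ) (g ∘ toℕ) ⟨
    ∑[ i < suc a ] (f (toℕ i) + g (toℕ i))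
      ≈⟨ sum-toℕ-cong (suc a) (λ k → f k + g k) (λ k → t k * (α k * h k + β k * h (suc k)))
           (λ k _ → trans (+-cong (*-assoc _ _ _) (*-assoc _ _ _)) (sym (distribˡ _ _ _))) ⟩
    ∑[ i < suc a ] (t (toℕ i) * (α (toℕ i) * h (toℕ i) + β (toℕ i) * h (suc (toℕ i)))) ∎
    where
    f g : ℕ → Carrier
    f k = t k * α k * h k
    g k = t k * β k * h (suc k)
    fₐ≈0 : f (suc a) ≈ 0#
    fₐ≈0 = trans (*-congʳ (trans (*-congʳ tₐ≈0) (zeroˡ _))) (zeroˡ _)

  module _ (x y q : Carrier) where

    -- The generating function of the choices of the first a blocks, k of them doubletons.
    prefix : ℕ → ℕ → Carrier
    prefix a k = x ^ (a ∸ k) * y ^ k * q ^ (a C 2 ℕ.+ k C 2) * gauss q a k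

    prefix-vanishes : ∀ a → prefix a (suc a) ≈ 0#
    prefix-vanishes a = trans (*-congˡ (gauss-vanishes q (ℕₚ.n<1+n a))) (zeroʳ _)

    prefix-zero : ∀ a → prefix (suc a) 0 ≈ prefix a 0 * (x * q ^ (a ℕ.+ 0))
    prefix-zero a = begin
      x * X * 1# * q ^ (suc a C 2 ℕ.+ 0) * 1#
        ≈⟨ *-congʳ (*-congˡ (trans (^-congʳ q (zero-exponent a)) (^-homo-* q (a ℕ.+ 0) (a C 2 ℕ.+ 0)))) ⟩
      x * X * 1# * (v * u) * 1#
        ≈⟨ solve 5 (λ x X o v u → x :* X :* o :* (v :* u) :* o := X :* o :* u :* o :* (x :* v))
             refl x X 1# v u ⟩
      X * 1# * u * 1# * (x * v) ∎
      where
      X = x ^ a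
      u = q ^ (a C 2 ℕ.+ 0)
      v = q ^ (a ℕ.+ 0)

    -- For k ≥ a, where the exponent a ∸ suc k is truncated, gauss vanishes.
    x^[a∸k]*gauss : ∀ a k → x ^ (a ∸ k) * gauss q a (suc k) ≈ x ^ (a ∸ suc k) * x * gauss q a (suc k)
    x^[a∸k]*gauss a k with ℕₚ.<-≤-connex k a
    ... | inj₁ k<a = *-congʳ (trans (^-congʳ x (ℕₚ.+-∸-assoc 1 k<a)) (*-comm _ _))
    ... | inj₂ a≤k = trans (*-congˡ g≈0) (trans (zeroʳ _) (sym (trans (*-congˡ g≈0) (zeroʳ _))))
      where g≈0 = gauss-vanishes q (s≤s a≤k)

    -- The last block is a singleton after a + k + 1 elements or a doubleton after a + k. In the
    -- first case the exponent absorbs the factor `q ^ suc k` of the q-Pascal recurrence.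
    prefix-suc : ∀ a k → prefix (suc a) (suc k)
                 ≈ prefix a (suc k) * (x * q ^ (a ℕ.+ suc k)) + prefix a k * (y * q ^ (a ℕ.+ k))
    prefix-suc a k = begin
      X * (y * Y) * w * (q ^ suc k * g′ + g)
        ≈⟨ solve 7 (λ X y Y w u h g → X :* (y :* Y) :* w :* (u :* h :+ g)
                                      := X :* h :* (y :* Y) :* (w :* u) :+ X :* Y :* g :* y :* w)
             refl X y Y w (q ^ suc k) g′ g ⟩
      X * g′ * (y * Y) * (w * q ^ suc k) + X * Y * g * y * w
        ≈⟨ +-cong (*-cong (*-congʳ (x^[a∸k]*gauss a k))
                     (split (suc a C 2 ℕ.+ suc k C 2) (suc k) (a C 2 ℕ.+ suc k C 2) (a ℕ.+ suc k)
                       (suc-C2-exponent a (suc k C 2) (suc k))))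
                  (*-congˡ (trans (^-congʳ q (pascal-exponent a k)) (^-homo-* q (a C 2 ℕ.+ k C 2) (a ℕ.+ k)))) ⟩
      X′ * x * g′ * (y * Y) * (w₁ * v₁) + X * Y * g * y * (w₂ * v₂)
        ≈⟨ +-cong
             (solve 6 (λ X x h Y w v → X :* x :* h :* Y :* (w :* v) := X :* Y :* w :* h :* (x :* v))
               refl X′ x g′ (y * Y) w₁ v₁)
             (solve 6 (λ X Y g y w v → X :* Y :* g :* y :* (w :* v) := X :* Y :* w :* g :* (y :* v))
               refl X Y g y w₂ v₂) ⟩
      X′ * (y * Y) * w₁ * g′ * (x * v₁) + X * Y * w₂ * g * (y * v₂) ∎
      where
      X  = x ^ (a ∸ k)
      X′ = x ^ (a ∸ suc k)
      Y  = y ^ k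
      g  = gauss q a k
      g′ = gauss q a (suc k)
      w  = q ^ (suc a C 2 ℕ.+ suc k C 2)
      w₁ = q ^ (a C 2 ℕ.+ suc k C 2)
      v₁ = q ^ (a ℕ.+ suc k)
      w₂ = q ^ (a C 2 ℕ.+ k C 2)
      v₂ = q ^ (a ℕ.+ k)
      split : ∀ i j i′ j′ → i ℕ.+ j ≡ i′ ℕ.+ j′ → q ^ i * q ^ j ≈ q ^ i′ * q ^ j′
      split i j i′ j′ e = trans (sym (^-homo-* q i j)) (trans (^-congʳ q e) (^-homo-* q i′ j′))

    -- The contribution of the remaining blocks: `a` blocks with `k` doubletons cover a + k
    -- elements, each of which gives a factor q to every later block.
    suffix : ℕ → ℕ → ℕ → Carrier
    suffix N a k = F (N ∸ (a ℕ.+ k)) (x * q ^ (a ℕ.+ k)) (y * q ^ (a ℕ.+ k)) q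

    -- The next block is a singleton, leaving `k` fixed, or a doubleton, raising it by 1; the bound
    -- leaves room for either.
    suffix-recurrence : ∀ {N} a k → 2 ℕ.+ (a ℕ.+ k) ≤ N →
      suffix N a k ≈ x * q ^ (a ℕ.+ k) * suffix N (suc a) k
                     + y * q ^ (a ℕ.+ k) * suffix N (suc a) (suc k)
    suffix-recurrence {N} a k 2+j≤N = trans
      (F-shift-recurrence j x y q (ℕₚ.m+n≤o⇒m≤o∸n 2 2+j≤N))
      (+-cong (*-congˡ (reindex 1 ≡.refl)) (*-congˡ (reindex 2 (≡.cong suc (≡.sym (ℕₚ.+-suc a k))))))
      where
      j = a ℕ.+ k
      reindex : ∀ i {l} → i ℕ.+ j ≡ l →
        F (N ∸ j ∸ i) (x * q ^ (i ℕ.+ j)) (y * q ^ (i ℕ.+ j)) q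
        ≈ F (N ∸ l) (x * q ^ l) (y * q ^ l) q
      reindex i ≡.refl = F-cong {N ∸ j ∸ i} q
        (≡.trans (ℕₚ.∸-+-assoc N j i) (≡.cong (N ∸_) (ℕₚ.+-comm j i))) refl refl

    -- Induction on `a` with `N` fixed moves one block at a time from the suffix to the prefix.
    -- Since `a` blocks cover at most 2a elements, the bound ensures that the cut exists.
    F≈prefix*suffix : ∀ N a → a ℕ.+ a ≤ N →
      F N x y q ≈ ∑[ i < suc a ] (prefix a (toℕ i) * suffix N a (toℕ i))
    F≈prefix*suffix N zero _ = begin
      F N x y q                                      ≈⟨ F-cong {N} q ≡.refl (sym (*-identityʳ x)) (sym (*-identityʳ y)) ⟩
      suffix N 0 0                                   ≈⟨ *-identityˡ _ ⟨
      1# * suffix N 0 0                              ≈⟨ *-congʳ (trans (*-identityʳ _) (trans (*-identityʳ _) (*-identityʳ _))) ⟨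
      prefix 0 0 * suffix N 0 0                      ≈⟨ +-identityʳ _ ⟨
      prefix 0 0 * suffix N 0 0 + 0#                 ∎
    F≈prefix*suffix N (suc a) 2+2a≤N = begin
      F N x y q
        ≈⟨ F≈prefix*suffix N a (ℕₚ.≤-trans (ℕₚ.m≤n+m (a ℕ.+ a) 2) bound) ⟩
      ∑[ i < suc a ] (prefix a (toℕ i) * suffix N a (toℕ i))
        ≈⟨ sum-toℕ-cong (suc a) (λ k → prefix a k * suffix N a k)
             (λ k → prefix a k * (x * q ^ (a ℕ.+ k) * suffix N (suc a) k
                                  + y * q ^ (a ℕ.+ k) * suffix N (suc a) (suc k)))
             (λ k k≤a → *-congˡ (suffix-recurrence a k
               (ℕₚ.≤-trans (ℕₚ.+-monoʳ-≤ 2 (ℕₚ.+-monoʳ-≤ a (ℕₚ.≤-pred k≤a))) bound))) ⟩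
      -- The suffix recurrence is the transpose of the prefix recurrence, with the same
      -- coefficients.
      _ ≈⟨ sum-pascal a (prefix a) (prefix (suc a)) (λ k → x * q ^ (a ℕ.+ k)) (λ k → y * q ^ (a ℕ.+ k))
             (suffix N (suc a)) (prefix-zero a) (prefix-suc a) (prefix-vanishes a) ⟨
      ∑[ i < suc (suc a) ] (prefix (suc a) (toℕ i) * suffix N (suc a) (toℕ i)) ∎
      where
      bound : 2 ℕ.+ (a ℕ.+ a) ≤ N
      bound = ≡.subst (_≤ N) (≡.cong suc (ℕₚ.+-suc a a)) 2+2a≤N

theorem4p7 : ∀ {c ℓ} (R : CommutativeRing c ℓ) →
    let open CommutativeRing R
        open Weighted R
    in (x y q : Carrier) (n : ℕ) (recip : ℕ → Carrier) → Reciprocals n q recip →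
       F (2 ℕ.* n) x y q
       ≈ ∑[ i < suc n ]
           (let k = toℕ i in
             x ^ (n ∸ k) * y ^ k * q ^ (((n ℕ.+ k) C 2) ∸ n ℕ.* k)
             * qBinomial q recip n k
             * F (n ∸ k) (x * q ^ (n ℕ.+ k)) (y * q ^ (n ℕ.+ k)) q)
theorem4p7 R x y q n recip inv = trans
  (F≈prefix*suffix R x y q (2 ℕ.* n) n (ℕₚ.≤-reflexive (≡.cong (n ℕ.+_) (≡.sym (ℕₚ.+-identityʳ n)))))
  (sum-toℕ-cong R (suc n)
    (λ k → prefix R x y q n k * suffix R x y q (2 ℕ.* n) n k)
    (λ k → x ^ (n ∸ k) * y ^ k * q ^ (((n ℕ.+ k) C 2) ∸ n ℕ.* k)
           * qBinomial q recip n k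
           * F (n ∸ k) (x * q ^ (n ℕ.+ k)) (y * q ^ (n ℕ.+ k)) q)
    λ k k<1+n → *-cong
      -- The cut is at a = n in a matching of [2n]: the exponent C(n,2) + C(k,2) is rewritten,
      -- `gauss` becomes `qBinomial`, and 2n - (n + k) = n - k elements remain.
      (*-cong (*-congˡ (^-congʳ q (≡.sym ([n+k]C2∸nk n k))))
              (sym (qBinomial≈gauss R inv k (ℕₚ.≤-pred k<1+n))))
      (F-cong R {2 ℕ.* n ∸ (n ℕ.+ k)} q
        (≡.trans (ℕₚ.[m+n]∸[m+o]≡n∸o n (n ℕ.+ 0) k) (≡.cong (_∸ k) (ℕₚ.+-identityʳ n))) refl refl))
  where
  open CommutativeRing R
  open Weighted R
  open SemiringExp semiring using (^-congʳ)
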